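{- Let $\Lambda_T=\{\rho(T) : T \text{ is a cop-win tree}\}$, where $T$ ranges over all (finite or infinite) cop-win trees. Then $$\Lambda_T=\omega\cup\{\alpha+\omega : \alpha \text{ is a nonzero limit ordinal}\}.$$ In other words, the CR-ordinal of a cop-win tree is either a finite ordinal or of the form $\alpha+\omega$ with $\alpha$ a nonzero limit ordinal, and every such ordinal is the CR-ordinal of some cop-win tree.
   Context: All graphs are simple and undirected, possibly infinite. For a vertex $v$ of a graph $G$, $N[v]$ denotes its closed neighbourhood. Define binary relations $\leq_\alpha$ on $V(G)$, for every ordinal $\alpha$, by transfinite recursion: $u\leq_0 v$ iff $u=v$; for $\alpha>0$, $u\leq_\alpha v$ iff for every $x\in N[u]$ there exist $y\in N[v]$ and an ordinal $\beta<\alpha$ with $x\leq_\beta y$. These relations increase with $\alpha$, and the CR-ordinal $\rho(G)$ is the least ordinal $\rho$ with $\leq_\rho=\leq_{\rho+1}$. A graph is cop-win if in the game of Cops and Robbers (a cop and a robber alternately move along edges or stay put, the cop choosing a starting vertex first, then the robber; the cop wins upon occupying the robber's vertex) a single cop has a strategy guaranteeing capture. It is known that a graph $G$ is cop-win iff the relation $\leq_\rho$ (for $\rho=\rho(G)$) is all of $V(G)\times V(G)$, and that a tree is cop-win iff it contains no ray (one-way infinite path). Here $\omega$ is the set of finite ordinals; a limit ordinal is a nonzero ordinal that is not a successor. -}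

module Defs where

open import Data.Empty.Polymorphic using (⊥; ⊥-elim)
open import Data.Fin using (Fin; zero; suc; inject₁; fromℕ)
open import Data.List using (List; []; _∷_)
open import Data.Nat as ℕ using (ℕ)
open import Data.Product using (_×_; _,_; ∃; ∃-syntax)
open import Data.Sum using (_⊎_; [_,_])
open import Data.Unit.Polymorphic using (⊤)
open import Function.Bundles using (_⇔_)
open import Function.Definitions using (Injective)
open import Level using (Level; Lift; lift) renaming (suc to lsuc)
open import Relation.Binary.Construct.Closure.ReflexiveTransitive using (Star)
open import Relation.Binary.Core using (Rel)
open import Relation.Binary.Definitions using (Symmetric)
open import Relation.Binary.PropositionalEquality using (_≡_)
open import Relation.Nullary using (¬_)
open import Relation.Unary using (Pred; _∈_)

-- Every ordinal is the least strict upper bound of a small family of smaller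
-- ordinals: lsub I f stands for the least ordinal greater than every f i.
-- Different families may name the same ordinal, so equality of ordinals is _≈_
-- below, not _≡_.  Classically, Ord ℓ modulo _≈_ ordered by _<_ is the class of
-- the order types of the well-ordered sets of Set ℓ.
data Ord (ℓ : Level) : Set (lsuc ℓ) where
  lsub : (I : Set ℓ) → (I → Ord ℓ) → Ord ℓ

module _ {ℓ : Level} where

  infix 4 _≤_ _<_ _≈_
  infixl 6 _⊕_

  mutual
    _≤_ : Ord ℓ → Ord ℓ → Set ℓ
    lsub I f ≤ β = ∀ i → f i < β

    _<_ : Ord ℓ → Ord ℓ → Set ℓ
    α < lsub J g = ∃[ j ] α ≤ g j

  _≈_ : Ord ℓ → Ord ℓ → Set ℓ
  α ≈ β = (α ≤ β) × (β ≤ α)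

  0ₒ : Ord ℓ
  0ₒ = lsub ⊥ ⊥-elim

  sucₒ : Ord ℓ → Ord ℓ
  sucₒ α = lsub ⊤ (λ _ → α)

  finite : ℕ → Ord ℓ
  finite ℕ.zero    = 0ₒ
  finite (ℕ.suc n) = sucₒ (finite n)

  ω : Ord ℓ
  ω = lsub (Lift ℓ ℕ) λ { (lift n) → finite n }

  -- Ordinal addition: α ⊕ β is the least ordinal greater than every γ < α and
  -- every α ⊕ γ with γ < β.
  _⊕_ : Ord ℓ → Ord ℓ → Ord ℓ
  lsub I f ⊕ lsub J g = lsub (I ⊎ J) [ f , (λ j → lsub I f ⊕ g j) ]

  IsLimit : Ord ℓ → Set (lsuc ℓ)
  IsLimit α = ¬ (α ≈ 0ₒ) × ¬ (∃[ β ] α ≈ sucₒ β)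

record Graph (ℓ : Level) : Set (lsuc ℓ) where
  infix 4 _~_
  field
    Vertex : Set ℓ
    _~_    : Rel Vertex ℓ
    ~-sym  : Symmetric _~_
    ~-irr  : ∀ {v} → ¬ (v ~ v)

  N[_] : Vertex → Pred Vertex ℓ
  N[ v ] x = (x ≡ v) ⊎ (v ~ x)

module _ {ℓ : Level} (G : Graph ℓ) where
  open Graph G

  Connected : Set ℓ
  Connected = ∀ u v → Star _~_ u v

  record Cycle : Set ℓ where
    field
      k        : ℕ
      vertex   : Fin (3 ℕ.+ k) → Vertex
      distinct : Injective _≡_ _≡_ vertex
      edges    : ∀ (i : Fin (2 ℕ.+ k)) → vertex (inject₁ i) ~ vertex (suc i)
      closing  : vertex (fromℕ (2 ℕ.+ k)) ~ vertex zero

  IsTree : Set ℓ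
  IsTree = Connected × ¬ Cycle

  -- The transfinite recursion defining the relations, written as an inductive
  -- family: since _<_ is well-founded, the equivalences given by the two
  -- constructors and their inversion have exactly one solution.
  infix 4 _≤[_]_
  data _≤[_]_ (u : Vertex) (α : Ord ℓ) (v : Vertex) : Set (lsuc ℓ) where
    base : α ≈ 0ₒ → u ≡ v → u ≤[ α ] v
    step : 0ₒ < α →
           (∀ x → x ∈ N[ u ] →
              ∃[ y ] (y ∈ N[ v ]) × (∃[ β ] (β < α) × (x ≤[ β ] y))) →
           u ≤[ α ] v

  StableAt : Ord ℓ → Set (lsuc ℓ)
  StableAt ρ = ∀ u v → (u ≤[ ρ ] v) ⇔ (u ≤[ sucₒ ρ ] v)

  IsCROrdinal : Ord ℓ → Set (lsuc ℓ)
  IsCROrdinal ρ = StableAt ρ × (∀ σ → StableAt σ → ρ ≤ σ)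

  -- A strategy gives the cop's current vertex as a function of the vertices
  -- the robber has occupied so far, the most recent one first; the cop's own
  -- earlier positions are determined by these.
  record CopStrategy : Set ℓ where
    field
      position : List Vertex → Vertex
      legal    : ∀ r h → position (r ∷ h) ∈ N[ position h ]

  -- An escape attempt is an infinite sequence of robber positions; the game
  -- is over at the first capture and whatever follows is irrelevant.
  record RobberPlay : Set ℓ where
    field
      position : ℕ → Vertex
      legal    : ∀ n → position (ℕ.suc n) ∈ N[ position n ]

    history : ℕ → List Vertex
    history ℕ.zero    = []
    history (ℕ.suc n) = position n ∷ history n

  -- The positions are taken in the order c₀, r₀, c₁, r₁, … , so a capture is
  -- cₙ ≡ rₙ (after the robber's turn) or cₙ₊₁ ≡ rₙ (after the cop's turn).
  Captures : CopStrategy → RobberPlay → Set ℓ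
  Captures s p = ∃[ n ] ((c n ≡ r n) ⊎ (c (ℕ.suc n) ≡ r n))
    where
    r c : ℕ → Vertex
    r n = RobberPlay.position p n
    c n = CopStrategy.position s (RobberPlay.history p n)

  CopWin : Set ℓ
  CopWin = ∃[ s ] ∀ p → Captures s p

Λ-T : (ℓ : Level) → Pred (Ord ℓ) (lsuc ℓ)
Λ-T ℓ ρ = ∃[ T ] IsTree T × CopWin T × IsCROrdinal T ρ

{-# OPTIONS --safe #-}

-- In a tree the cop always steps towards the robber, so the game from cop v,
-- robber at a neighbour w lasts exactly as long as the rank h(v→w) of the
-- branch at w away from v, and ρ(T) is the supremum of h over directed edges.
-- Let R be the rank of T rooted at some r.  Moving the root by one edge changes
-- the rank by at most one, and a vertex at depth n forces n ≤ R, so every h is at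
-- most R + n for some finite n ≤ R: a finite R makes ρ(T) finite.  If R = λ + k
-- with λ a limit, some vertex s has branches of ranks below λ but cofinal in λ.
-- Removing one of them keeps the rest cofinal, so looking back at s from depth n
-- inside such a branch one sees rank at least λ + n; hence ρ(T) = λ + ω.
-- Conversely an ordinal, being a well-founded tree of smaller ordinals, is itself
-- a rayless tree of the required rank, and finite n gives the path with n edges.
module Submission where

open import Defs
open import Axiom.ExcludedMiddle using (ExcludedMiddle)
import Data.Empty as Empty
open import Data.Fin using (Fin; zero; suc; inject₁; fromℕ; toℕ)
open import Data.Fin.Induction using (<-weakInduction; <-weakInduction-startingFrom)
open import Data.Fin.Properties using (toℕ-inject₁; toℕ-fromℕ; toℕ<n; toℕ-injective; suc-injective; ≤fromℕ)
open import Data.List using (List; []; _∷_)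
open import Data.Maybe using (Maybe; just; nothing)
import Data.Maybe as Maybe
open import Data.Maybe.Properties using (just-injective)
open import Data.Nat as ℕ using (ℕ; zero; suc; s≤s; z≤n)
import Data.Nat.Properties as ℕₚ
open import Data.Product using (_×_; _,_; ∃-syntax; Σ; proj₁; proj₂)
open import Data.Sum using (_⊎_; inj₁; inj₂; [_,_])
open import Data.Unit.Polymorphic using (tt)
open import Function.Base using (_∘_)
open import Function.Bundles using (mk⇔; Equivalence)
open import Level using (Level; Lift; lift) renaming (suc to lsuc)
open import Relation.Binary.Construct.Closure.ReflexiveTransitive using (Star; ε; _◅_; _◅◅_; reverse)
open import Relation.Binary.PropositionalEquality using (_≡_; _≢_; refl; sym; trans; cong; subst)
open import Relation.Nullary using (¬_; Dec; yes; no; contradiction)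
open import Relation.Unary using (_∪_; _≐_; _∈_)

private variable
  ℓ : Level

-- Ordinals

≤-refl : (α : Ord ℓ) → α ≤ α
≤-refl (lsub I f) i = i , ≤-refl (f i)

mutual
  ≤-trans : (α β γ : Ord ℓ) → α ≤ β → β ≤ γ → α ≤ γ
  ≤-trans (lsub I f) β γ p q i = <-≤-trans (f i) β γ (p i) q

  <-≤-trans : (α β γ : Ord ℓ) → α < β → β ≤ γ → α < γ
  <-≤-trans α (lsub J g) (lsub K h) (j , p) q =
    proj₁ (q j) , ≤-trans α (g j) (h (proj₁ (q j))) p (proj₂ (q j))

≤-<-trans : (α β γ : Ord ℓ) → α ≤ β → β < γ → α < γ
≤-<-trans α β (lsub K h) p (k , q) = k , ≤-trans α β (h k) p q

<⇒≤ : (α β : Ord ℓ) → α < β → α ≤ β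
<⇒≤ (lsub I f) (lsub J g) (j , p) i = j , <⇒≤ (f i) (g j) (p i)

<-irrefl : (α : Ord ℓ) → ¬ (α < α)
<-irrefl (lsub I f) (i , p) = <-irrefl (f i) (p i)

0≤ : (α : Ord ℓ) → 0ₒ ≤ α
0≤ α ()

<-sucₒ : (α : Ord ℓ) → α < sucₒ α
<-sucₒ α = tt , ≤-refl α

≤-sucₒ : (α : Ord ℓ) → α ≤ sucₒ α
≤-sucₒ α = <⇒≤ α (sucₒ α) (<-sucₒ α)

0<sucₒ : (α : Ord ℓ) → 0ₒ < sucₒ α
0<sucₒ α = tt , 0≤ α

sucₒ-mono : (α β : Ord ℓ) → α ≤ β → sucₒ α ≤ sucₒ β
sucₒ-mono α β p _ = tt , p

<⇒sucₒ≤ : (α β : Ord ℓ) → α < β → sucₒ α ≤ β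
<⇒sucₒ≤ α β p _ = p

≈-sym : (α β : Ord ℓ) → α ≈ β → β ≈ α
≈-sym α β (p , q) = q , p

≈-trans : (α β γ : Ord ℓ) → α ≈ β → β ≈ γ → α ≈ γ
≈-trans α β γ (p , p′) (q , q′) = ≤-trans α β γ p q , ≤-trans γ β α q′ p′

-- The ordinal α + n, in a form that computes on `n`; it agrees with `α ⊕ finite n` up to `≈`.
sucs : ℕ → Ord ℓ → Ord ℓ
sucs zero    α = α
sucs (suc n) α = sucₒ (sucs n α)

sucs-sucₒ : (n : ℕ) (α : Ord ℓ) → sucs n (sucₒ α) ≡ sucs (suc n) α
sucs-sucₒ zero    α = refl
sucs-sucₒ (suc n) α = cong sucₒ (sucs-sucₒ n α)

sucs-mono : (n : ℕ) (α β : Ord ℓ) → α ≤ β → sucs n α ≤ sucs n β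
sucs-mono zero    α β p = p
sucs-mono (suc n) α β p = sucₒ-mono (sucs n α) (sucs n β) (sucs-mono n α β p)

sucs-mono-< : (n : ℕ) (α β : Ord ℓ) → α < β → sucs (suc n) α ≤ sucs n β
sucs-mono-< n α β p =
  subst (_≤ sucs n β) (sucs-sucₒ n α) (sucs-mono n (sucₒ α) β (<⇒sucₒ≤ α β p))

≤-sucs : (n : ℕ) (α : Ord ℓ) → α ≤ sucs n α
≤-sucs zero    α = ≤-refl α
≤-sucs (suc n) α = ≤-trans α (sucs n α) _ (≤-sucs n α) (≤-sucₒ (sucs n α))

sucs-monoˡ : (m n : ℕ) (α : Ord ℓ) → finite {ℓ} m ≤ finite n → sucs m α ≤ sucs n α
sucs-monoˡ zero    n       α p = ≤-sucs n α
sucs-monoˡ (suc m) zero    α p = contradiction (p tt) λ ()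
sucs-monoˡ (suc m) (suc n) α p =
  sucₒ-mono (sucs m α) (sucs n α) (sucs-monoˡ m n α (proj₂ (p tt)))

sucs-+ : (m n : ℕ) (α : Ord ℓ) → sucs m (sucs n α) ≡ sucs (m ℕ.+ n) α
sucs-+ zero    n α = refl
sucs-+ (suc m) n α = cong sucₒ (sucs-+ m n α)

sucs-finite : (m n : ℕ) → sucs m (finite {ℓ} n) ≡ finite (m ℕ.+ n)
sucs-finite zero    n = refl
sucs-finite (suc m) n = cong sucₒ (sucs-finite m n)

finite≤sucs : (n : ℕ) (α : Ord ℓ) → finite n ≤ sucs n α
finite≤sucs zero    α = 0≤ α
finite≤sucs (suc n) α = sucₒ-mono (finite n) (sucs n α) (finite≤sucs n α)

⊕-finite≤sucs : (α : Ord ℓ) (n : ℕ) → α ⊕ finite n ≤ sucs n α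
⊕-finite≤sucs (lsub I f) zero    (inj₁ i) = i , ≤-refl (f i)
⊕-finite≤sucs α@(lsub I f) (suc n) (inj₁ i) =
  tt , ≤-trans (f i) α (sucs n α) (<⇒≤ (f i) α (i , ≤-refl (f i))) (≤-sucs n α)
⊕-finite≤sucs α@(lsub I f) (suc n) (inj₂ _) = tt , ⊕-finite≤sucs α n

sucs≤⊕-finite : (α : Ord ℓ) (n : ℕ) → sucs n α ≤ α ⊕ finite n
sucs≤⊕-finite (lsub I f) zero    i = inj₁ i , ≤-refl (f i)
sucs≤⊕-finite α@(lsub I f) (suc n) _ = inj₂ tt , sucs≤⊕-finite α n

sucs≤⊕ω : (α : Ord ℓ) (n : ℕ) → sucs n α ≤ α ⊕ ω
sucs≤⊕ω α@(lsub I f) n =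
  <⇒≤ (sucs n α) (α ⊕ ω) (inj₂ (lift n) , sucs≤⊕-finite α n)

⊕ω-least : (α σ : Ord ℓ) → (∀ n → sucs n α ≤ σ) → α ⊕ ω ≤ σ
⊕ω-least α@(lsub I f) σ p (inj₁ i)        = p 0 i
⊕ω-least α@(lsub I f) σ p (inj₂ (lift n)) =
  ≤-<-trans (α ⊕ finite n) (sucs n α) σ (⊕-finite≤sucs α n) (p (suc n) tt)

-- 1 + α; the rank of a branch is 1 + (rank of its tree of children), because
-- capturing a robber on a leaf takes one round.
1⊕ : Ord ℓ → Ord ℓ
1⊕ (lsub I f) = lsub (Maybe I) (Maybe.maybe (1⊕ ∘ f) 0ₒ)

0<1⊕ : (α : Ord ℓ) → 0ₒ < 1⊕ α
0<1⊕ (lsub I f) = nothing , 0≤ 0ₒ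

mutual
  1⊕-mono : (α β : Ord ℓ) → α ≤ β → 1⊕ α ≤ 1⊕ β
  1⊕-mono (lsub I f) β p (just i) = 1⊕-mono-< (f i) β (p i)
  1⊕-mono (lsub I f) β p nothing  = 0<1⊕ β

  1⊕-mono-< : (α β : Ord ℓ) → α < β → 1⊕ α < 1⊕ β
  1⊕-mono-< α (lsub J g) (j , p) = just j , 1⊕-mono α (g j) p

≤1⊕ : (α : Ord ℓ) → α ≤ 1⊕ α
≤1⊕ (lsub I f) i = just i , ≤1⊕ (f i)

1⊕≤sucₒ : (α : Ord ℓ) → 1⊕ α ≤ sucₒ α
1⊕≤sucₒ (lsub I f) (just i) = tt , ≤-trans (1⊕ (f i)) (sucₒ (f i)) (lsub I f)
  (1⊕≤sucₒ (f i)) (<⇒sucₒ≤ (f i) (lsub I f) (i , ≤-refl (f i)))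
1⊕≤sucₒ (lsub I f) nothing  = 0<sucₒ (lsub I f)

sucₒ≤1⊕-finite : (n : ℕ) → sucₒ (finite {ℓ} n) ≤ 1⊕ (finite n)
sucₒ≤1⊕-finite zero    _ = nothing , 0≤ 0ₒ
sucₒ≤1⊕-finite (suc n) _ = just tt , sucₒ≤1⊕-finite n

-- The tree of an ordinal

-- Positions in the well-founded tree lsub I f; nothing is the root.
Pos : Ord ℓ → Set ℓ
Pos (lsub I f) = Maybe (Σ I (Pos ∘ f))

root : (α : Ord ℓ) → Pos α
root (lsub I f) = nothing

parent : (α : Ord ℓ) → Pos α → Maybe (Pos α)
parent (lsub I f) nothing        = nothing
-- If `x` is the root of its subtree, the inner `nothing` is read as a position, namely the root of
-- `lsub I f`.
parent (lsub I f) (just (i , x)) = just (Maybe.map (i ,_) (parent (f i) x))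

depth : (α : Ord ℓ) → Pos α → ℕ
depth (lsub I f) nothing        = 0
depth (lsub I f) (just (i , x)) = suc (depth (f i) x)

subtree : (α : Ord ℓ) → Pos α → Ord ℓ
subtree (lsub I f) nothing        = lsub I f
subtree (lsub I f) (just (i , x)) = subtree (f i) x

subtree-root : (α : Ord ℓ) → subtree α (root α) ≡ α
subtree-root (lsub I f) = refl

parent-root : (α : Ord ℓ) → parent α (root α) ≡ nothing
parent-root (lsub I f) = refl

orphan⇒root : (α : Ord ℓ) (x : Pos α) → parent α x ≡ nothing → x ≡ root α
orphan⇒root (lsub I f) nothing _ = refl

depth-root : (α : Ord ℓ) → depth α (root α) ≡ 0
depth-root (lsub I f) = refl

depth-parent : (α : Ord ℓ) {x y : Pos α} → parent α x ≡ just y → depth α x ≡ suc (depth α y)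
depth-parent (lsub I f) {just (i , x)} eq with parent (f i) x in eq′
depth-parent (lsub I f) {just (i , x)} refl | nothing
  rewrite orphan⇒root (f i) x eq′ = cong suc (depth-root (f i))
depth-parent (lsub I f) {just (i , x)} refl | just z = cong suc (depth-parent (f i) eq′)

subtree-parent : (α : Ord ℓ) {x y : Pos α} → parent α x ≡ just y → subtree α x < subtree α y
subtree-parent (lsub I f) {just (i , x)} eq with parent (f i) x in eq′
subtree-parent (lsub I f) {just (i , x)} refl | nothing
  rewrite orphan⇒root (f i) x eq′ | subtree-root (f i) = i , ≤-refl (f i)
subtree-parent (lsub I f) {just (i , x)} refl | just z = subtree-parent (f i) eq′

<subtree⇒child : (α : Ord ℓ) (x : Pos α) (γ : Ord ℓ) → γ < subtree α x →
                 ∃[ y ] (parent α y ≡ just x) × (γ ≤ subtree α y)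
<subtree⇒child (lsub I f) nothing γ (i , p) =
  just (i , root (f i)) , cong (just ∘ Maybe.map (i ,_)) (parent-root (f i)) ,
  subst (γ ≤_) (sym (subtree-root (f i))) p
<subtree⇒child (lsub I f) (just (i , x)) γ p =
  let y , eq , q = <subtree⇒child (f i) x γ p in
  just (i , y) , cong (just ∘ Maybe.map (i ,_)) eq , q

-- The tree of `finite n` is a path: every family in it has at most one index.
depth-injective : (n : ℕ) (x y : Pos (finite {ℓ} n)) → depth (finite n) x ≡ depth (finite n) y → x ≡ y
depth-injective zero    nothing         nothing         _  = refl
depth-injective (suc n) nothing         nothing         _  = refl
depth-injective (suc n) (just (tt , x)) (just (tt , y)) eq =
  cong (λ z → just (tt , z)) (depth-injective n x y (ℕₚ.suc-injective eq))

Fin-increasing : ∀ {n} (f : Fin (2 ℕ.+ n) → ℕ) → (∀ i → f (inject₁ i) ℕ.< f (suc i)) →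
                 f zero ℕ.< f (fromℕ (suc n))
Fin-increasing f inc = <-weakInduction (λ i → f zero ℕ.< f (suc i)) (inc zero)
  (λ i p → ℕₚ.<-trans p (inc (suc i))) (fromℕ _)

Fin-decreasing : ∀ {n} (f : Fin (2 ℕ.+ n) → ℕ) → (∀ i → f (suc i) ℕ.< f (inject₁ i)) →
                 f (fromℕ (suc n)) ℕ.< f zero
Fin-decreasing f dec = <-weakInduction (λ i → f (suc i) ℕ.< f zero) (dec zero)
  (λ i p → ℕₚ.<-trans (dec (suc i)) p) (fromℕ _)

module OrdTree {ℓ : Level} (α : Ord ℓ) where

  _⋖_ : Pos α → Pos α → Set ℓ
  x ⋖ y = parent α x ≡ just y

  ⋖-unique : ∀ {x y z} → x ⋖ y → x ⋖ z → y ≡ z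
  ⋖-unique p q = just-injective (trans (sym p) q)

  ⋖-depth : ∀ {x y} → x ⋖ y → depth α y ℕ.< depth α x
  ⋖-depth p = ℕₚ.≤-reflexive (sym (depth-parent α p))

  ⋖-asym : ∀ {x y} → x ⋖ y → ¬ (y ⋖ x)
  ⋖-asym p q = ℕₚ.<-asym (⋖-depth p) (⋖-depth q)

  tree : Graph ℓ
  tree = record
    { Vertex = Pos α
    ; _~_    = λ x y → (x ⋖ y) ⊎ (y ⋖ x)
    ; ~-sym  = [ inj₂ , inj₁ ]
    ; ~-irr  = [ (λ p → ⋖-asym p p) , (λ p → ⋖-asym p p) ]
    }

  open Graph tree

  connected : Connected tree
  connected x y = to-root (depth α x) x ℕₚ.≤-refl
               ◅◅ reverse ~-sym (to-root (depth α y) y ℕₚ.≤-refl)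
    where
    to-root : ∀ n x → depth α x ℕ.≤ n → Star _~_ x (root α)
    to-root n x d≤ with parent α x in eq
    ... | nothing rewrite orphan⇒root α x eq = ε
    to-root zero    x d≤ | just y = contradiction (ℕₚ.<-≤-trans (⋖-depth eq) d≤) λ ()
    to-root (suc n) x d≤ | just y =
      inj₁ eq ◅ to-root n y (ℕₚ.≤-pred (ℕₚ.<-≤-trans (⋖-depth eq) d≤))

  -- A walk without backtracking never turns upwards after a step downwards.
  acyclic : ¬ Cycle tree
  acyclic record { k = k ; vertex = v ; distinct = distinct ; edges = edges ; closing = closing } =
    cases (edges zero) closing
    where
    last = fromℕ (2 ℕ.+ k)

    Descends Ascends : Fin (2 ℕ.+ k) → Set _
    Descends i = v (suc i) ⋖ v (inject₁ i)
    Ascends  i = v (inject₁ i) ⋖ v (suc i)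

    clash : ∀ {i j} → i ≢ j → v i ≢ v j
    clash i≢j eq = i≢j (distinct eq)

    two-apart : ∀ {n} (i : Fin n) → inject₁ (inject₁ i) ≢ suc (suc i)
    two-apart zero    ()
    two-apart (suc i) eq = two-apart i (suc-injective eq)

    persist : ∀ i → Descends (inject₁ i) → Descends (suc i)
    persist i d with edges (suc i)
    -- Going up would lead back to the unique parent, which is the vertex two places earlier.
    ... | inj₁ up   = contradiction (⋖-unique d up) (clash (two-apart i))
    ... | inj₂ down = down

    persist-last : ∀ i → Descends i → Descends (fromℕ (suc k))
    persist-last i d = <-weakInduction-startingFrom Descends d persist (≤fromℕ i)

    -- The directions of the first and the closing edge either give some vertex two distinct parents
    -- or make the depth monotone all the way round.
    cases : (v zero ⋖ v (suc zero)) ⊎ (v (suc zero) ⋖ v zero) →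
            (v last ⋖ v zero) ⊎ (v zero ⋖ v last) → Empty.⊥
    cases (inj₂ down) (inj₁ up) =
      clash (λ ()) (⋖-unique (persist-last zero down) up)
    cases (inj₂ down) (inj₂ up) = ℕₚ.<-asym (⋖-depth up)
      (Fin-increasing (depth α ∘ v) λ i → ⋖-depth (<-weakInduction Descends down persist i))
    cases (inj₁ up) (inj₂ up′) = clash (λ ()) (⋖-unique up up′)
    cases (inj₁ _) (inj₁ up) =
      ℕₚ.<-asym (⋖-depth up) (Fin-decreasing (depth α ∘ v) (⋖-depth ∘ ascends))
      where
      ascends : ∀ i → Ascends i
      ascends i with edges i
      ... | inj₁ a = a
      ... | inj₂ d = contradiction (⋖-unique up (persist-last i d)) (clash (λ ()))

-- Comparability and limit ordinals under excluded middle

module Classical {ℓ : Level} (em : ExcludedMiddle (lsuc ℓ)) where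

  dec : (P : Set ℓ) → Dec P
  dec P with em {Lift (lsuc ℓ) P}
  ... | yes (lift p) = yes p
  ... | no ¬p        = no (λ p → ¬p (lift p))

  ¬∀⇒∃¬ : {A : Set ℓ} {P : A → Set ℓ} → ¬ (∀ x → P x) → ∃[ x ] ¬ P x
  ¬∀⇒∃¬ {A} {P} ¬∀ with dec (∃[ x ] ¬ P x)
  ... | yes p = p
  ... | no ¬∃ = contradiction all ¬∀
    where
    all : ∀ x → P x
    all x with dec (P x)
    ... | yes p = p
    ... | no ¬p = contradiction (x , ¬p) ¬∃

  ≤-or-> : (α β : Ord ℓ) → (α ≤ β) ⊎ (β < α)
  ≤-or-> α@(lsub I f) β@(lsub J g) with dec (α ≤ β)
  ... | yes p = inj₁ p
  ... | no ¬p with ¬∀⇒∃¬ ¬p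
  -- An `f i` that is not below `β` exceeds every `g j`, so `β ≤ f i`.
  ...   | i , ¬q = inj₂ (i , λ j → [ (λ r → contradiction (j , r) ¬q) , (λ r → r) ] (≤-or-> (f i) (g j)))

  module _ (λₒ : Ord ℓ) (lim : IsLimit λₒ) where

    0<limit : 0ₒ < λₒ
    0<limit with ≤-or-> λₒ 0ₒ
    ... | inj₁ p = contradiction (p , 0≤ λₒ) (proj₁ lim)
    ... | inj₂ p = p

    sucₒ<limit : ∀ μ → μ < λₒ → sucₒ μ < λₒ
    sucₒ<limit μ p with ≤-or-> λₒ (sucₒ μ)
    ... | inj₁ q = contradiction (μ , q , <⇒sucₒ≤ μ λₒ p) (proj₂ lim)
    ... | inj₂ q = q

    finite<limit : ∀ n → finite n < λₒ
    finite<limit zero    = 0<limit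
    finite<limit (suc n) = sucₒ<limit (finite n) (finite<limit n)

  -- A limit absorbs a one added on the left, so the extra round at the leaves does not change the
  -- rank of the tree of a limit ordinal.
  1⊕-limit : (λₒ : Ord ℓ) → IsLimit λₒ → 1⊕ λₒ ≤ λₒ
  1⊕-limit λₒ@(lsub I f) lim nothing  = 0<limit λₒ lim
  1⊕-limit λₒ@(lsub I f) lim (just i) = ≤-<-trans (1⊕ (f i)) (sucₒ (f i)) λₒ
    (1⊕≤sucₒ (f i)) (sucₒ<limit λₒ lim (f i) (i , ≤-refl (f i)))

  finite-or-limit+finite : (α : Ord ℓ) →
    (∃[ k ] α ≈ finite k) ⊎ (∃[ λₒ ] ∃[ k ] IsLimit λₒ × (α ≈ sucs k λₒ))
  finite-or-limit+finite α@(lsub I f) with em {IsLimit α}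
  ... | yes lim = inj₂ (α , 0 , lim , ≤-refl α , ≤-refl α)
  ... | no ¬lim with em {Lift (lsuc ℓ) (α ≈ 0ₒ)}
  ...   | yes (lift p) = inj₁ (0 , p)
  ...   | no α≉0 with em {∃[ β ] α ≈ sucₒ β}
  ...     | no ¬suc = contradiction ((λ p → α≉0 (lift p)) , ¬suc) ¬lim
  -- The predecessor `β` need not be a subterm of `α`; the recursion uses a member `f i ≥ β` of the
  -- family, which is a predecessor as well.
  ...     | yes (β , α≤ , ≤α) = add (finite-or-limit+finite (f i))
    where
    i = proj₁ (≤α tt)

    α≈ : α ≈ sucₒ (f i)
    α≈ = ≤-trans α (sucₒ β) (sucₒ (f i)) α≤ (sucₒ-mono β (f i) (proj₂ (≤α tt)))
       , <⇒sucₒ≤ (f i) α (i , ≤-refl (f i))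

    sucₒ≈ : ∀ γ → f i ≈ γ → α ≈ sucₒ γ
    sucₒ≈ γ (p , q) = ≈-trans α (sucₒ (f i)) (sucₒ γ) α≈ (sucₒ-mono (f i) γ p , sucₒ-mono γ (f i) q)

    add : (∃[ k ] f i ≈ finite k) ⊎ (∃[ λₒ ] ∃[ k ] IsLimit λₒ × (f i ≈ sucs k λₒ)) →
          (∃[ k ] α ≈ finite k) ⊎ (∃[ λₒ ] ∃[ k ] IsLimit λₒ × (α ≈ sucs k λₒ))
    add (inj₁ (k , p))            = inj₁ (suc k , sucₒ≈ (finite k) p)
    add (inj₂ (λₒ , k , lim , p)) = inj₂ (λₒ , suc k , lim , sucₒ≈ (sucs k λₒ) p)

  -- Walks without backtracking, and rays

  module InGraph (G : Graph ℓ) where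
    open Graph G

    -- Path x p y: a walk from x to y without backtracking, whose second vertex is p.
    data Path : Vertex → Vertex → Vertex → Set ℓ where
      [_]  : ∀ {x p} → x ~ p → Path x p p
      cons : ∀ {x p q y} → x ~ p → q ≢ x → Path p q y → Path x p y

    first-edge : ∀ {x p y} → Path x p y → x ~ p
    first-edge [ e ]        = e
    first-edge (cons e _ _) = e

    -- A move at the far end extends the walk, deletes its last edge or changes nothing, and keeps
    -- the first step unless the walk collapses to a point. It tracks whichever player stands at
    -- that end.
    move-end : ∀ {x p y z} → Path x p y → z ∈ N[ y ] → (z ≡ x) ⊎ Path x p z
    move-end W (inj₁ refl) = inj₂ W
    move-end {x} {z = z} [ e ] (inj₂ y~z) with dec (z ≡ x)
    ... | yes z≡x = inj₁ z≡x
    ... | no z≢x  = inj₂ (cons e z≢x [ y~z ])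
    move-end (cons e q≢x W) (inj₂ y~z) with move-end W (inj₂ y~z)
    ... | inj₁ refl = inj₂ [ e ]
    ... | inj₂ W′   = inj₂ (cons e q≢x W′)

    reduce : ∀ {x y} → Star _~_ x y → (x ≡ y) ⊎ (∃[ p ] Path x p y)
    reduce ε = inj₁ refl
    reduce {x} (_◅_ {j = z} e s) with reduce s
    ... | inj₁ refl = inj₂ (_ , [ e ])
    ... | inj₂ (p , W) with dec (p ≡ x)
    ...   | no p≢x = inj₂ (z , cons e p≢x W)
    -- The new edge is retraced at once, so the two edges cancel.
    reduce (e ◅ s) | inj₂ (p , [ _ ])         | yes refl = inj₁ refl
    reduce (e ◅ s) | inj₂ (p , cons _ _ W)    | yes refl = inj₂ (_ , W)

    len : ∀ {x p y} → Path x p y → ℕ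
    len [ _ ]        = 1
    len (cons _ _ W) = suc (len W)

    -- The n-th vertex of the walk; constant from n = len W on.
    at : ∀ {x p y} → Path x p y → ℕ → Vertex
    at {x} W zero = x
    at {p = p} [ _ ] (suc n) = p
    at (cons _ _ W) (suc n) = at W n

    at-one : ∀ {x p y} (W : Path x p y) → at W 1 ≡ p
    at-one [ _ ]        = refl
    at-one (cons _ _ W) = refl

    at-len : ∀ {x p y} (W : Path x p y) → at W (len W) ≡ y
    at-len [ _ ]        = refl
    at-len (cons _ _ W) = at-len W

    at-edge : ∀ {x p y} (W : Path x p y) n → n ℕ.< len W → at W n ~ at W (suc n)
    at-edge W zero _ = subst (_ ~_) (sym (at-one W)) (first-edge W)
    at-edge [ _ ] (suc n) (s≤s ())
    at-edge (cons _ _ W) (suc n) (s≤s n<) = at-edge W n n<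

    module Acyclic (¬cycle : ¬ Cycle G) where

      at-injective : ∀ {x p y} (W : Path x p y) m n → m ℕ.≤ len W → n ℕ.≤ len W →
                     at W m ≡ at W n → m ≡ n
      -- The vertices of `W` are distinct, so a return to `x` closes a cycle. Indices 0 and 1 are
      -- excluded by `~-irr` and by the ban on backtracking, which leaves at least the three
      -- vertices that `Cycle` demands.
      no-return : ∀ {x p q y} → x ~ p → q ≢ x → (W : Path p q y) → ∀ n → n ℕ.≤ len W →
                  x ≢ at W n

      at-injective W zero zero _ _ _ = refl
      at-injective [ e ] zero (suc n) _ _ refl = contradiction e ~-irr
      at-injective [ e ] (suc m) zero _ _ refl = contradiction e ~-irr
      at-injective [ e ] (suc zero) (suc zero) _ _ _ = refl
      at-injective [ e ] (suc (suc m)) _ (s≤s ()) _ _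
      at-injective [ e ] (suc zero) (suc (suc n)) _ (s≤s ()) _
      at-injective (cons e ne W) zero (suc n) _ (s≤s n≤) eq = contradiction eq (no-return e ne W n n≤)
      at-injective (cons e ne W) (suc m) zero (s≤s m≤) _ eq = contradiction (sym eq) (no-return e ne W m m≤)
      at-injective (cons e ne W) (suc m) (suc n) (s≤s m≤) (s≤s n≤) eq =
        cong suc (at-injective W m n m≤ n≤ eq)

      no-return e ne W zero _ refl = ~-irr e
      no-return e ne W (suc zero) _ eq = ne (sym (trans eq (at-one W)))
      no-return {x} e ne W (suc (suc k)) n≤ eq = ¬cycle record
        { k        = k
        ; vertex   = at W ∘ toℕ
        ; distinct = λ {i} {j} p → toℕ-injective
            (at-injective W (toℕ i) (toℕ j) (bound i) (bound j) p)
        ; edges    = λ i → subst (λ m → at W m ~ at W (suc (toℕ i))) (sym (toℕ-inject₁ i))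
            (at-edge W (toℕ i) (ℕₚ.≤-trans (toℕ<n i) n≤))
        ; closing  = subst (λ v → v ~ at W 0)
            (trans eq (cong (at W) (sym (toℕ-fromℕ (2 ℕ.+ k))))) e
        }
        where
        bound : (i : Fin (3 ℕ.+ k)) → toℕ i ℕ.≤ len W
        bound i = ℕₚ.≤-trans (ℕₚ.≤-pred (toℕ<n i)) n≤

      ends-differ : ∀ {x p y} → Path x p y → x ≢ y
      ends-differ W eq = 0≢len W (at-injective W 0 (len W) z≤n ℕₚ.≤-refl (trans eq (sym (at-len W))))
        where
        0≢len : ∀ {x p y} (W : Path x p y) → 0 ≢ len W
        0≢len [ _ ] ()
        0≢len (cons _ _ _) ()

      -- If the first steps differ, prefixing `W′` with the edge from `p` to `x` gives another walk
      -- from `p` to `y`. When `W` is one edge, that walk is closed; otherwise comparing it with the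
      -- shorter tail of `W` makes `W` backtrack.
      first-step-unique : ∀ {x p q y} → Path x p y → Path x q y → p ≡ q
      first-step-unique {x} {p} {q} {y} W W′ with dec (p ≡ q)
      ... | yes p≡q = p≡q
      ... | no p≢q = contradiction refl (absurd W)
        where
        back : Path p x y
        back = cons (~-sym (first-edge W)) (λ q≡p → p≢q (sym q≡p)) W′

        absurd : Path x p y → y ≢ y
        absurd [ e ] = ends-differ back
        absurd (cons e r≢x V) = contradiction (first-step-unique V back) r≢x

    -- No ray from w avoids v in its second vertex; by irreflexivity Rayless v v
    -- excludes every ray from v.
    data Rayless (v w : Vertex) : Set ℓ where
      rayless : (∀ x → w ~ x → x ≢ v → Rayless w x) → Rayless v w

    -- If all branches at a vertex are rayless, so are all branches at each neighbour; this is
    -- carried along a walk from `r`.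
    rayless-everywhere : Connected G → ∀ {r} → Rayless r r → ∀ v w → Rayless v w
    rayless-everywhere conn {r} (rayless start) v w = rayless λ x w~x _ → out (conn r w) from-root x w~x
      where
      from-root : ∀ x → r ~ x → Rayless r x
      from-root x r~x = start x r~x (λ { refl → ~-irr r~x })

      out : ∀ {u u′} → Star _~_ u u′ → (∀ x → u ~ x → Rayless u x) → ∀ x → u′ ~ x → Rayless u′ x
      out ε p = p
      out {u} (_◅_ {j = z} e s) p = out s next
        where
        next : ∀ x → z ~ x → Rayless z x
        next x z~x with dec (x ≡ u) | p z e
        ... | yes refl | _         = rayless λ y u~y _ → p y u~y
        ... | no x≢u   | rayless q = q x z~x x≢u

    -- Cop-win trees and rayless trees

    module _ (conn : Connected G) (¬cycle : ¬ Cycle G) where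
      open Acyclic ¬cycle

      path : ∀ x y → x ≢ y → ∃[ p ] Path x p y
      path x y x≢y with reduce (conn x y)
      ... | inj₁ x≡y = contradiction x≡y x≢y
      ... | inj₂ W   = W

      module _ (allRayless : ∀ v w → Rayless v w) (start : Vertex) where

        towards : Vertex → Vertex → Vertex
        towards c x with dec (c ≡ x)
        ... | yes _  = c
        ... | no c≢x = proj₁ (path c x c≢x)

        towards-legal : ∀ c x → towards c x ∈ N[ c ]
        towards-legal c x with dec (c ≡ x)
        ... | yes _  = inj₁ refl
        ... | no c≢x = inj₂ (first-edge (proj₂ (path c x c≢x)))

        towards-path : ∀ {c w x} → Path c w x → towards c x ≡ w
        towards-path {c} {w} {x} W with dec (c ≡ x)
        ... | yes c≡x = contradiction c≡x (ends-differ W)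
        ... | no c≢x  = first-step-unique (proj₂ (path c x c≢x)) W

        chase : CopStrategy G
        chase = record { position = pos ; legal = λ r h → towards-legal (pos h) r }
          where
          pos : List Vertex → Vertex
          pos []      = start
          pos (x ∷ h) = towards (pos h) x

        chase-captures : ∀ p → Captures G chase p
        chase-captures p with dec (start ≡ RobberPlay.position p 0)
        ... | yes eq = 0 , inj₁ eq
        ... | no ne  = let w , W = path _ _ ne in go (allRayless start w) 0 refl W
          where
          open RobberPlay p using (legal; history) renaming (position to r)

          c : ℕ → Vertex
          c n = CopStrategy.position chase (history n)

          -- Invariant: the cop stands at `v` and the walk to the robber starts with `w`. The robber
          -- cannot get past the cop, so each round without capture descends one level in `Rayless`.
          go : ∀ {v w} → Rayless v w → ∀ n → c n ≡ v → Path v w (r n) → Captures G chase p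
          go _ n refl W@([ e ]) = n , inj₂ (towards-path W)
          go (rayless ρ) n refl W@(cons e q≢v V) with move-end V (legal n)
          ... | inj₁ eq = suc n , inj₁ (trans (towards-path W) (sym eq))
          ... | inj₂ V′ = go (ρ _ (first-edge V) q≢v) (suc n) (towards-path W) V′

        rayless⇒copWin : CopWin G
        rayless⇒copWin = chase , chase-captures

      -- A robber who starts two steps ahead of the cop on a ray and runs along it
      -- is never caught.
      module _ (s : CopStrategy G) where
        private start = CopStrategy.position s []

        Ray : Set ℓ
        Ray = Σ Vertex λ v → Σ Vertex λ w → ¬ Rayless v w

        extend : ∀ {v w} → ¬ Rayless v w → ∃[ x ] (w ~ x) × (x ≢ v) × ¬ Rayless w x
        extend {v} {w} ¬R with dec (∃[ x ] (w ~ x) × (x ≢ v) × ¬ Rayless w x)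
        ... | yes p = p
        ... | no ¬p = contradiction (rayless continue) ¬R
          where
          continue : ∀ x → w ~ x → x ≢ v → Rayless w x
          continue x w~x x≢v with dec (Rayless w x)
          ... | yes R = R
          ... | no ¬R = contradiction (x , w~x , x≢v , ¬R) ¬p

        shift : Ray → Ray
        shift (v , w , ¬R) = let x , _ , _ , ¬R′ = extend ¬R in w , x , ¬R′

        module Escape {w₀ w₁ : Vertex} (e₀ : start ~ w₀) (e₁ : w₀ ~ w₁) (w₁≢ : w₁ ≢ start)
                      (¬R : ¬ Rayless w₀ w₁) where

          run : ℕ → Ray
          run zero    = w₀ , w₁ , ¬R
          run (suc n) = shift (run n)

          prev cur : ℕ → Vertex
          prev n = proj₁ (run n)
          cur n  = proj₁ (proj₂ (run n))

          play : RobberPlay G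
          play = record
            { position = cur
            ; legal    = λ n → inj₂ (proj₁ (proj₂ (extend (proj₂ (proj₂ (run n)))))) }

          c : ℕ → Vertex
          c n = CopStrategy.position s (RobberPlay.history play n)

          no-closing-edge : ∀ {x p y} → Path x p y → p ≢ y → ¬ (y ~ x)
          no-closing-edge W p≢y y~x = ends-differ (cons y~x p≢y W) refl

          -- Before the cop's reply (`behind`) the cop is at least two steps away, on the side the
          -- robber came from; after it (`missed`) the cop is still on that side and has not
          -- arrived.
          behind : ∀ n → Path (cur n) (prev n) (c n) × (prev n ≢ c n)
          missed : ∀ n → Path (cur n) (prev n) (c (suc n))

          behind zero = cons (~-sym e₁) (λ eq → w₁≢ (sym eq)) [ ~-sym e₀ ]
                      , λ { refl → ~-irr e₀ }
          behind (suc n) with extend (proj₂ (proj₂ (run n)))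
          ... | x , w~x , x≢v , _ = cons (~-sym w~x) (λ eq → x≢v (sym eq)) (missed n)
                                  , ends-differ (missed n)

          missed n with CopStrategy.legal s (cur n) (RobberPlay.history play n)
          ... | m with move-end (proj₁ (behind n)) m
          ...   | inj₂ W  = W
          ...   | inj₁ eq with m
          ...     | inj₁ eq′ = contradiction (trans (sym eq) eq′) (ends-differ (proj₁ (behind n)))
          ...     | inj₂ e   = contradiction (subst (c n ~_) eq e)
                                 (no-closing-edge (proj₁ (behind n)) (proj₂ (behind n)))

          escapes : ¬ Captures G s play
          escapes (n , inj₁ eq) = ends-differ (proj₁ (behind n)) (sym eq)
          escapes (n , inj₂ eq) = ends-differ (missed n) (sym eq)

        winning⇒rayless : (∀ p → Captures G s p) → Rayless start start
        winning⇒rayless win with dec (Rayless start start)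
        ... | yes R = R
        ... | no ¬R = let w₀ , e₀ , _ , ¬R₀ = extend ¬R
                          w₁ , e₁ , w₁≢ , ¬R₁ = extend ¬R₀
                          open Escape e₀ e₁ w₁≢ ¬R₁
                      in contradiction (win play) escapes

    -- Ranks of branches

    -- The index `nothing` gives a leaf rank one instead of zero.
    rank : ∀ {v w} → Rayless v w → Ord ℓ
    rank {v} {w} (rayless ρ) =
      lsub (Maybe (Σ Vertex λ x → (w ~ x) × (x ≢ v)))
           (Maybe.maybe (λ { (x , w~x , x≢v) → rank (ρ x w~x x≢v) }) 0ₒ)

    rank-irrelevant : ∀ {v w} (R R′ : Rayless v w) → rank R ≤ rank R′
    rank-irrelevant (rayless ρ) (rayless ρ′) nothing = nothing , 0≤ 0ₒ
    rank-irrelevant (rayless ρ) (rayless ρ′) (just (x , a , b)) =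
      just (x , a , b) , rank-irrelevant (ρ x a b) (ρ′ x a b)

    module Heights (allRayless : ∀ v w → Rayless v w) where

      h : Vertex → Vertex → Ord ℓ
      h v w = rank (allRayless v w)

      0<h : ∀ v w → 0ₒ < h v w
      0<h v w with allRayless v w
      ... | rayless ρ = nothing , 0≤ 0ₒ

      h-child : ∀ v w x → w ~ x → x ≢ v → h w x < h v w
      h-child v w x w~x x≢v with allRayless v w
      ... | rayless ρ = just (x , w~x , x≢v) , rank-irrelevant (allRayless w x) (ρ x w~x x≢v)

      h-bound : ∀ v w σ → 0ₒ < σ → (∀ x → w ~ x → x ≢ v → h w x < σ) → h v w ≤ σ
      h-bound v w σ pos p with allRayless v w
      ... | rayless ρ = λ where
        nothing            → pos
        (just (x , a , b)) → ≤-<-trans (rank (ρ x a b)) (h w x) σ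
                               (rank-irrelevant (ρ x a b) (allRayless w x)) (p x a b)

      <h : ∀ v w μ → μ < h v w → (μ ≤ 0ₒ) ⊎ (∃[ x ] (w ~ x) × (x ≢ v) × (μ ≤ h w x))
      <h v w μ p with allRayless v w
      <h v w μ (nothing , p)          | rayless ρ = inj₁ p
      <h v w μ (just (x , a , b) , p) | rayless ρ = inj₂ (x , a , b ,
        ≤-trans μ (rank (ρ x a b)) (h w x) p (rank-irrelevant (ρ x a b) (allRayless w x)))

    -- The relations and their stabilisation in a rayless tree

    ≤[]-mono : ∀ {u v} α β → α ≤ β → _≤[_]_ G u α v → _≤[_]_ G u β v
    ≤[]-mono α β p (step pos f) = step (<-≤-trans 0ₒ α β pos p) λ x x∈ →
      let y , y∈ , γ , γ<α , r = f x x∈ in y , y∈ , γ , <-≤-trans γ α β γ<α p , r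
    ≤[]-mono α β p (base _ refl) with ≤-or-> β 0ₒ
    ... | inj₁ β≤0 = base (β≤0 , 0≤ β) refl
    -- `base` is available only at zero; at a positive index the cop copies the robber's move.
    ... | inj₂ 0<β = step 0<β λ x x∈ → x , x∈ , 0ₒ , 0<β , base (0≤ 0ₒ , 0≤ 0ₒ) refl

    ≤[]-refl : ∀ α u → _≤[_]_ G u α u
    ≤[]-refl α u = ≤[]-mono 0ₒ α (0≤ α) (base (0≤ 0ₒ , 0≤ 0ₒ) refl)

    module RaylessTree (conn : Connected G) (¬cycle : ¬ Cycle G) (allRayless : ∀ v w → Rayless v w) where
      open Acyclic ¬cycle
      open Heights allRayless

      IsBound : Ord ℓ → Set ℓ
      IsBound σ = ∀ v w → v ~ w → h v w ≤ σ

      -- The cop steps to `w`, the first vertex towards the robber, or waits if the robber comes to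
      -- `v`. The next branch has smaller rank, so the index `h v w` suffices.
      all-≤[_] : ∀ ρ → IsBound ρ → ∀ u v → _≤[_]_ G u ρ v
      all-≤[ ρ ] bound u v with dec (v ≡ u)
      ... | yes refl = ≤[]-refl ρ v
      ... | no v≢u   = let w , W = path conn ¬cycle v u v≢u in
                       ≤[]-mono (h v w) ρ (bound v w (first-edge W)) (catch (allRayless v w) W)
        where
        catch : ∀ {u v w} → Rayless v w → Path v w u → _≤[_]_ G u (h v w) v
        catch {u} {v} {w} (rayless ρ) W = step (0<h v w) answer
          where
          answer : ∀ x → x ∈ N[ u ] →
            ∃[ y ] (y ∈ N[ v ]) × (∃[ β ] (β < h v w) × (_≤[_]_ G x β y))
          answer x x∈ with move-end W x∈
          ... | inj₁ refl = v , inj₁ refl , 0ₒ , 0<h v w , ≤[]-refl 0ₒ v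
          ... | inj₂ [ e ] = w , inj₂ e , 0ₒ , 0<h v w , ≤[]-refl 0ₒ w
          ... | inj₂ (cons {q = q} e q≢v V) = w , inj₂ e , h w q ,
            h-child v w q (first-edge V) q≢v , catch (ρ q (first-edge V) q≢v) V

      -- The same chase, by induction on `Rayless` alone: each round costs one successor, which
      -- stability gives back.
      stable⇒all : ∀ ρ → StableAt G ρ → ∀ u v → _≤[_]_ G u ρ v
      stable⇒all ρ stable u v with dec (v ≡ u)
      ... | yes refl = ≤[]-refl ρ v
      ... | no v≢u   = let w , W = path conn ¬cycle v u v≢u in catch (allRayless v w) W
        where
        catch : ∀ {u v w} → Rayless v w → Path v w u → _≤[_]_ G u ρ v
        catch {u} {v} {w} (rayless R) W = Equivalence.from (stable u v) (step (0<sucₒ ρ) answer)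
          where
          answer : ∀ x → x ∈ N[ u ] →
            ∃[ y ] (y ∈ N[ v ]) × (∃[ β ] (β < sucₒ ρ) × (_≤[_]_ G x β y))
          answer x x∈ with move-end W x∈
          ... | inj₁ refl = v , inj₁ refl , ρ , <-sucₒ ρ , ≤[]-refl ρ v
          ... | inj₂ [ e ] = w , inj₂ e , ρ , <-sucₒ ρ , ≤[]-refl ρ w
          ... | inj₂ (cons {q = q} e q≢v V) = w , inj₂ e , ρ , <-sucₒ ρ ,
            catch (R q (first-edge V) q≢v) V

      -- The robber flees away from the cop, who stays behind in direction p.
      h≤ : ∀ {x p y} α → Path x p y → _≤[_]_ G x α y → h p x ≤ α
      h≤ α W (base _ x≡y) = contradiction x≡y (ends-differ W)
      h≤ {x} {p} {y} α W (step 0<α f) = h-bound p x α 0<α flee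
        where
        flee : ∀ c → x ~ c → c ≢ p → h x c < α
        flee c x~c c≢p with f c (inj₂ x~c)
        ... | y′ , y′∈ , β , β<α , c≤y′ with move-end W y′∈
        ...   | inj₁ refl = ≤-<-trans (h x c) β α (h≤ β [ ~-sym x~c ] c≤y′) β<α
        ...   | inj₂ W′ = ≤-<-trans (h x c) β α
                            (h≤ β (cons (~-sym x~c) (λ p≡c → c≢p (sym p≡c)) W′) c≤y′) β<α

      stable⇒bound : ∀ ρ → StableAt G ρ → IsBound ρ
      stable⇒bound ρ stable v w v~w = h≤ ρ [ ~-sym v~w ] (stable⇒all ρ stable w v)

      bound⇒stable : ∀ ρ → IsBound ρ → StableAt G ρ
      bound⇒stable ρ bound u v =
        mk⇔ (≤[]-mono ρ (sucₒ ρ) (≤-sucₒ ρ)) (λ _ → all-≤[ ρ ] bound u v)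

      -- The stable ordinals are exactly the bounds of `h`, so the CR-ordinal is the least bound.
      lub⇒CROrdinal : ∀ ρ → IsBound ρ → (∀ σ → IsBound σ → ρ ≤ σ) → IsCROrdinal G ρ
      lub⇒CROrdinal ρ bound least =
        bound⇒stable ρ bound , λ σ stable → least σ (stable⇒bound σ stable)

      CROrdinal-resp-≈ : ∀ ρ σ → ρ ≈ σ → IsCROrdinal G ρ → IsCROrdinal G σ
      CROrdinal-resp-≈ ρ σ (ρ≤σ , σ≤ρ) (stable , least) = lub⇒CROrdinal σ
        (λ v w v~w → ≤-trans (h v w) ρ σ (stable⇒bound ρ stable v w v~w) ρ≤σ)
        (λ τ bound → ≤-trans σ ρ τ σ≤ρ (least τ (bound⇒stable τ bound)))

      -- Ranks seen from a root

      module Rooted (r : Vertex) where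

        -- No neighbour of `r` equals `r`, so no branch is left out: this is the rank of the whole
        -- tree rooted at `r`.
        R : Ord ℓ
        R = h r r

        -- x is a child of p, and p has depth n.
        data Down : ℕ → Vertex → Vertex → Set ℓ where
          top   : ∀ {x} → r ~ x → Down 0 r x
          below : ∀ {n p x y} → Down n p x → x ~ y → y ≢ p → Down (suc n) x y

        locate : ∀ {u v} → Star _~_ u v → (u ≡ r) ⊎ (∃[ n ] ∃[ p ] Down n p u) →
                 (v ≡ r) ⊎ (∃[ n ] ∃[ p ] Down n p v)
        locate ε d = d
        locate (e ◅ s) (inj₁ refl) = locate s (inj₂ (0 , r , top e))
        locate (_◅_ {j = z} e s) (inj₂ (n , p , d)) with dec (z ≡ p)
        ... | no z≢p = locate s (inj₂ (suc n , _ , below d e z≢p))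
        locate (e ◅ s) (inj₂ (_ , p , top _))       | yes refl = locate s (inj₁ refl)
        locate (e ◅ s) (inj₂ (_ , p , below d _ _)) | yes refl = locate s (inj₂ (_ , _ , d))

        down-depth : ∀ {n p x} → Down n p x → sucs n (h p x) ≤ R
        down-depth (top {x} e) =
          <⇒≤ (h r x) R (h-child r r x e (λ { refl → ~-irr e }))
        down-depth (below {n} {p} {x} {y} d e y≢p) =
          ≤-trans (sucs (suc n) (h x y)) (sucs n (h p x)) R
            (sucs-mono-< n (h x y) (h p x) (h-child p x y e y≢p)) (down-depth d)

        down-finite : ∀ {n p x} → Down n p x → finite n ≤ R
        down-finite {n} {p} {x} d =
          ≤-trans (finite n) (sucs n (h p x)) R (finite≤sucs n (h p x)) (down-depth d)

        down≤ : ∀ {n p x} → Down n p x → h p x ≤ R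
        down≤ {n} {p} {x} d = ≤-trans (h p x) (sucs n (h p x)) R (≤-sucs n (h p x)) (down-depth d)

        -- The branch seen looking up from a vertex consists of its parent's other children, of rank
        -- at most `R`, and of what the parent sees looking up; each level therefore adds at most
        -- one.
        up≤ : ∀ {n p x} → Down n p x → h x p ≤ sucs n R
        up≤ (top {x} e) = h-bound x r R (0<h r r)
          (λ y r~y _ → h-child r r y r~y (λ { refl → ~-irr r~y }))
        up≤ (below {n} {p} {x} {y} d e y≢p) = h-bound y x (sucs (suc n) R) (0<sucₒ (sucs n R)) other
          where
          other : ∀ z → x ~ z → z ≢ y → h x z < sucs (suc n) R
          other z x~z _ with dec (z ≡ p)
          ... | yes refl = tt , up≤ d
          ... | no z≢p   = tt , ≤-trans (h x z) R (sucs n R)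
            (≤-trans (h x z) (h p x) R (<⇒≤ (h x z) (h p x) (h-child p x z x~z z≢p)) (down≤ d))
            (≤-sucs n R)

        h≤sucs-R : ∀ v w → v ~ w → ∃[ n ] (finite n ≤ R) × (h v w ≤ sucs n R)
        h≤sucs-R v w v~w with locate (conn r v) (inj₁ refl)
        ... | inj₁ refl = 0 , 0≤ R , down≤ (top v~w)
        ... | inj₂ (n , p , d) with dec (w ≡ p)
        ...   | yes refl = n , down-finite d , up≤ d
        ...   | no w≢p   = 0 , 0≤ R , down≤ (below d v~w w≢p)

        finite-rank : ∀ k → R ≤ finite k → ∀ ρ → IsCROrdinal G ρ → ρ < ω
        -- One `k` bounds `R`, the other the depth from which one looks back.
        finite-rank k R≤k ρ (_ , least) = lift (k ℕ.+ k) ,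
          least (finite (k ℕ.+ k)) (bound⇒stable _ bound)
          where
          bound : IsBound (finite (k ℕ.+ k))
          bound v w v~w with h≤sucs-R v w v~w
          ... | n , n≤R , p = subst (h v w ≤_) (sucs-finite k k)
            (≤-trans (h v w) (sucs n R) (sucs k (finite k)) p
              (≤-trans (sucs n R) (sucs k R) (sucs k (finite k))
                (sucs-monoˡ n k R (≤-trans (finite n) R (finite k) n≤R R≤k))
                (sucs-mono k R (finite k) R≤k)))

        -- Rank a finite distance above a limit

        module _ (λₒ : Ord ℓ) (lim : IsLimit λₒ) where

          Cofinal : Vertex → Set (lsuc ℓ)
          Cofinal s = ∀ μ → μ < λₒ → ∃[ c ] (s ~ c) × (μ ≤ h s c) × (h s c < λₒ)

          -- Descend as long as some child branch has rank at least `λₒ`; raylessness ends the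
          -- descent, and the vertex reached has the property.
          find-cofinal : ∀ {p s} → Rayless p s → λₒ ≤ h p s → ∃[ t ] Cofinal t
          find-cofinal {p} {s} (rayless ρ) λ≤ with dec (∃[ c ] (s ~ c) × (c ≢ p) × (λₒ ≤ h s c))
          ... | yes (c , s~c , c≢p , λ≤c) = find-cofinal (ρ c s~c c≢p) λ≤c
          ... | no ¬c = s , cofinal
            where
            cofinal : Cofinal s
            -- Asking for `sucₒ μ` excludes the outcome of `<h` that supplies no neighbour.
            cofinal μ μ<λ with <h p s (sucₒ μ) (<-≤-trans (sucₒ μ) λₒ (h p s) (sucₒ<limit λₒ lim μ μ<λ) λ≤)
            ... | inj₁ sμ≤0 = contradiction (sμ≤0 tt) λ ()
            ... | inj₂ (c , s~c , c≢p , sμ≤) with ≤-or-> λₒ (h s c)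
            ...   | inj₁ λ≤c = contradiction (c , s~c , c≢p , λ≤c) ¬c
            ...   | inj₂ c<λ = c , s~c , <⇒≤ μ (h s c) (sμ≤ tt) , c<λ

          -- If `h c s` were below `λₒ`, some branch at `s` would have rank above both `h s c` and
          -- `h c s`. The first makes it differ from the branch at `c`, so it is part of the branch
          -- of rank `h c s`, which is too small to hold it.
          λ≤h-back : ∀ {s c} → Cofinal s → s ~ c → h s c < λₒ → λₒ ≤ h c s
          λ≤h-back {s} {c} cofinal s~c c<λ with ≤-or-> λₒ (h c s)
          ... | inj₁ p = p
          ... | inj₂ back<λ = contradiction clash (<-irrefl (h c s))
            where
            clash : h c s < h c s
            clash with ≤-or-> (h s c) (h c s)
            ... | inj₁ p = above (cofinal (sucₒ (h c s)) (sucₒ<limit λₒ lim (h c s) back<λ))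
              where
              above : ∃[ d ] (s ~ d) × (sucₒ (h c s) ≤ h s d) × (h s d < λₒ) → h c s < h c s
              above (d , s~d , q , _) = ≤-<-trans (h c s) (h s d) (h c s)
                (<⇒≤ (h c s) (h s d) (q tt))
                (h-child c s d s~d λ { refl → <-irrefl (h c s) (<-≤-trans (h c s) (h s d) (h c s) (q tt) p) })
            ... | inj₂ p = above (cofinal (sucₒ (h s c)) (sucₒ<limit λₒ lim (h s c) c<λ))
              where
              above : ∃[ d ] (s ~ d) × (sucₒ (h s c) ≤ h s d) × (h s d < λₒ) → h c s < h c s
              above (d , s~d , q , _) = ≤-<-trans (h c s) (h s d) (h c s)
                (<⇒≤ (h c s) (h s d) (<-≤-trans (h c s) (h s c) (h s d) p (<⇒≤ (h s c) (h s d) (q tt))))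
                (h-child c s d s~d λ { refl → <-irrefl (h s c) (q tt) })

          -- Walking `n` steps into the branch at `b` raises the rank seen looking back by at least
          -- one per step. Rank `suc n` leaves room for them, because a leaf already has rank one.
          recede : ∀ n {a b} τ → a ~ b → finite (suc n) ≤ h a b → τ ≤ h b a →
                   ∃[ v ] ∃[ w ] (v ~ w) × (sucs n τ ≤ h v w)
          recede zero {a} {b} τ a~b _ τ≤ = b , a , ~-sym a~b , τ≤
          recede (suc n) {a} {b} τ a~b deep τ≤ with <h a b (finite (suc n)) (deep tt)
          ... | inj₁ p = contradiction (p tt) λ ()
          ... | inj₂ (c , b~c , c≢a , deep′) =
            let v , w , v~w , p = recede n (sucₒ τ) b~c deep′
                  (<⇒sucₒ≤ τ (h c b) (≤-<-trans τ (h b a) (h c b) τ≤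
                    (h-child c b a (~-sym a~b) (λ a≡c → c≢a (sym a≡c)))))
            in v , w , v~w , subst (_≤ h v w) (sucs-sucₒ n τ) p

          limit-rank : ∀ k → R ≈ sucs k λₒ → IsCROrdinal G (λₒ ⊕ ω)
          limit-rank k (R≤ , ≤R) = lub⇒CROrdinal (λₒ ⊕ ω) bound
            (λ σ bnd → ⊕ω-least λₒ σ λ n → let v , w , v~w , p = large n in
              ≤-trans (sucs n λₒ) (h v w) σ p (bnd v w v~w))
            where
            bound : IsBound (λₒ ⊕ ω)
            bound v w v~w with h≤sucs-R v w v~w
            ... | n , _ , p = ≤-trans (h v w) (sucs n R) (λₒ ⊕ ω) p
              (≤-trans (sucs n R) (sucs n (sucs k λₒ)) (λₒ ⊕ ω) (sucs-mono n R (sucs k λₒ) R≤)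
                (subst (_≤ λₒ ⊕ ω) (sym (sucs-+ n k λₒ)) (sucs≤⊕ω λₒ (n ℕ.+ k))))

            large : ∀ n → ∃[ v ] ∃[ w ] (v ~ w) × (sucs n λₒ ≤ h v w)
            large n =
              let s , cofinal = find-cofinal (allRayless r r) (≤-trans λₒ (sucs k λₒ) R (≤-sucs k λₒ) ≤R)
                  c , s~c , deep , c<λ = cofinal (finite (suc n)) (finite<limit λₒ lim (suc n))
              in recede n λₒ s~c deep (λ≤h-back cofinal s~c c<λ)

  -- CR-ordinals of arbitrary cop-win trees

  module CopWinTree (T : Graph ℓ) (conn : Connected T) (¬cycle : ¬ Cycle T) (cop : CopWin T) where
    open InGraph T
    open RaylessTree conn ¬cycle
      (rayless-everywhere conn (winning⇒rayless conn ¬cycle (proj₁ cop) (proj₂ cop)))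
    open Rooted (CopStrategy.position (proj₁ cop) [])

    classify : ∀ ρ → IsCROrdinal T ρ → (ρ < ω) ⊎ (∃[ α ] IsLimit α × (ρ ≈ α ⊕ ω))
    classify ρ cr with finite-or-limit+finite R
    ... | inj₁ (k , R≤k , _) = inj₁ (finite-rank k R≤k ρ cr)
    ... | inj₂ (λₒ , k , lim , R≈) =
      let stable , least = limit-rank λₒ lim k R≈ in
      inj₂ (λₒ , lim , proj₂ cr (λₒ ⊕ ω) stable , least ρ (proj₁ cr))

  -- Realising limits plus ω and finite ordinals

  module Realise (α : Ord ℓ) where
    open OrdTree α
    open Graph tree
    open InGraph tree

    -- Subtrees shrink strictly on the way down; `β` is the structural argument that makes this
    -- descent terminate.
    rayless-down : ∀ β {p x} → x ⋖ p → subtree α x ≤ β → Rayless p x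
    rayless-down (lsub J g) {p} {x} x⋖p sub≤ = rayless next
      where
      next : ∀ y → x ~ y → y ≢ p → Rayless x y
      next y (inj₁ x⋖y) y≢p = contradiction (⋖-unique x⋖y x⋖p) y≢p
      next y (inj₂ y⋖x) _ =
        let j , q = <-≤-trans (subtree α y) (subtree α x) (lsub J g) (subtree-parent α y⋖x) sub≤
        in rayless-down (g j) y⋖x q

    orphan-root : ∀ {y} → ¬ (root α ⋖ y)
    orphan-root p with trans (sym p) (parent-root α)
    ... | ()

    root-rayless : Rayless (root α) (root α)
    root-rayless = rayless λ where
      y (inj₁ p) _ → contradiction p orphan-root
      y (inj₂ p) _ → rayless-down (subtree α y) p (≤-refl _)

    allRayless : ∀ v w → Rayless v w
    allRayless = rayless-everywhere connected root-rayless

    open Heights allRayless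
    open RaylessTree connected acyclic allRayless
    open Rooted (root α)

    copWin : CopWin tree
    copWin = rayless⇒copWin connected acyclic allRayless (root α)

    h-down≤ : ∀ {p x} → Rayless p x → x ⋖ p → h p x ≤ 1⊕ (subtree α x)
    h-down≤ {p} {x} (rayless ρ) x⋖p = h-bound p x _ (0<1⊕ (subtree α x)) children
      where
      children : ∀ y → x ~ y → y ≢ p → h x y < 1⊕ (subtree α x)
      children y (inj₁ x⋖y) y≢p = contradiction (⋖-unique x⋖y x⋖p) y≢p
      children y (inj₂ y⋖x) y≢p = ≤-<-trans (h x y) _ _ (h-down≤ (ρ y (inj₂ y⋖x) y≢p) y⋖x)
        (1⊕-mono-< _ _ (subtree-parent α y⋖x))

    -- Assuming only that `x` is not the parent of `p` admits `p` and `x` both equal to the root, as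
    -- `R` requires.
    ≤h : ∀ β {p x} → ¬ (p ⋖ x) → β ≤ subtree α x → 1⊕ β ≤ h p x
    ≤h (lsub J g) {p} {x} p⋖̸x β≤ nothing  = 0<h p x
    ≤h (lsub J g) {p} {x} p⋖̸x β≤ (just j) with <subtree⇒child α x (g j) (β≤ j)
    ... | y , y⋖x , gj≤ = ≤-<-trans (1⊕ (g j)) (h x y) (h p x)
      (≤h (g j) (⋖-asym y⋖x) gj≤) (h-child p x y (inj₂ y⋖x) λ { refl → p⋖̸x y⋖x })

    R≈ : R ≈ 1⊕ α
    R≈ = h-bound (root α) (root α) (1⊕ α) (0<1⊕ α) children
       , ≤h α (λ p → ⋖-asym p p) (subst (α ≤_) (sym (subtree-root α)) (≤-refl α))
      where
      children : ∀ y → root α ~ y → y ≢ root α → h (root α) y < 1⊕ α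
      children y (inj₁ p) _ = contradiction p orphan-root
      children y (inj₂ p) _ = ≤-<-trans (h (root α) y) (1⊕ (subtree α y)) (1⊕ α)
        (h-down≤ (allRayless (root α) y) p)
        (1⊕-mono-< _ _ (subst (subtree α y <_) (subtree-root α) (subtree-parent α p)))

    limit-realised : IsLimit α → ∀ ρ → ρ ≈ α ⊕ ω → Λ-T ℓ ρ
    limit-realised lim ρ ρ≈ = tree , (connected , acyclic) , copWin ,
      CROrdinal-resp-≈ (α ⊕ ω) ρ (≈-sym ρ (α ⊕ ω) ρ≈) (limit-rank α lim 0
        (≈-trans R (1⊕ α) α R≈ (1⊕-limit α lim , ≤1⊕ α)))

    sucs-depth≤ : ∀ n x → depth α x ≡ n → sucs n (subtree α x) ≤ α
    sucs-depth≤ n x eq with parent α x in eq′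
    sucs-depth≤ n x eq | nothing rewrite orphan⇒root α x eq′ | depth-root α | sym eq | subtree-root α = ≤-refl α
    sucs-depth≤ zero x eq | just y = contradiction (trans (sym (depth-parent α eq′)) eq) λ ()
    sucs-depth≤ (suc n) x eq | just y =
      ≤-trans (sucs (suc n) (subtree α x)) (sucs n (subtree α y)) α
        (sucs-mono-< n _ _ (subtree-parent α eq′))
        (sucs-depth≤ n y (ℕₚ.suc-injective (trans (sym (depth-parent α eq′)) eq)))

    finite-depth≤ : ∀ x → finite (depth α x) ≤ α
    finite-depth≤ x = ≤-trans (finite (depth α x)) (sucs (depth α x) (subtree α x)) α
      (finite≤sucs _ _) (sucs-depth≤ _ x refl)

    -- The bound is `α` and not `1⊕ α`: the extra round at a leaf is paid for by the step from `p`
    -- down to `x`.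
    h-down≤α : ∀ {p x} → x ⋖ p → h p x ≤ α
    h-down≤α {p} {x} x⋖p = ≤-trans (h p x) (1⊕ (subtree α x)) α (h-down≤ (allRayless p x) x⋖p)
      (≤-trans (1⊕ (subtree α x)) (sucₒ (subtree α x)) α (1⊕≤sucₒ _)
        (≤-trans (sucₒ (subtree α x)) (subtree α p) α (<⇒sucₒ≤ _ _ (subtree-parent α x⋖p))
          (≤-trans (subtree α p) (sucs (depth α p) (subtree α p)) α
            (≤-sucs (depth α p) _) (sucs-depth≤ _ p refl))))

    module _ (only-child : ∀ {p x y} → x ⋖ p → y ⋖ p → x ≡ y) where

      -- Without siblings, all that is seen looking up from `x` is the path to the root.
      h-up≤ : ∀ n {p x} → depth α x ≡ n → x ⋖ p → h x p ≤ finite n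
      h-up≤ zero    eq x⋖p = contradiction (trans (sym (depth-parent α x⋖p)) eq) λ ()
      h-up≤ (suc n) {p} {x} eq x⋖p = h-bound x p (finite (suc n)) (0<sucₒ (finite n)) above
        where
        above : ∀ y → p ~ y → y ≢ x → h p y < finite (suc n)
        above y (inj₂ y⋖p) y≢x = contradiction (only-child y⋖p x⋖p) y≢x
        above y (inj₁ p⋖y) _   =
          tt , h-up≤ n (ℕₚ.suc-injective (trans (sym (depth-parent α x⋖p)) eq)) p⋖y

      path-bound : IsBound α
      path-bound v w (inj₁ v⋖w) = ≤-trans (h v w) (finite (depth α v)) α
        (h-up≤ (depth α v) refl v⋖w) (finite-depth≤ v)
      path-bound v w (inj₂ w⋖v) = h-down≤α w⋖v

      path-realised : ∀ n → α ≡ finite n → ∀ ρ → ρ ≈ α → Λ-T ℓ ρ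
      path-realised n eq ρ ρ≈ = tree , (connected , acyclic) , copWin ,
        CROrdinal-resp-≈ α ρ (≈-sym ρ α ρ≈) (lub⇒CROrdinal α path-bound (least n eq))
        where
        least : ∀ n → α ≡ finite n → ∀ σ → IsBound σ → α ≤ σ
        least zero    eq σ _     = subst (_≤ σ) (sym eq) (0≤ σ)
        least (suc m) eq σ bound =
          -- The edge from the root to its child attains the bound, as 1 + m and m + 1 agree for
          -- finite `m`.
          let y , y⋖root , m≤ = <subtree⇒child α (root α) (finite m)
                (subst (finite m <_) (sym (trans (subtree-root α) eq)) (<-sucₒ (finite m)))
              h₁ = h (root α) y
          in subst (_≤ σ) (sym eq)
            (≤-trans (finite (suc m)) (1⊕ (finite m)) σ (sucₒ≤1⊕-finite m)
              (≤-trans (1⊕ (finite m)) h₁ σ (≤h (finite m) orphan-root m≤)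
                (bound (root α) y (inj₂ y⋖root))))

  finite-realised : ∀ n ρ → ρ ≈ finite n → Λ-T ℓ ρ
  finite-realised n = path-realised only-child n refl
    where
    open Realise (finite n)
    open OrdTree (finite {ℓ} n)
    only-child : ∀ {p x y} → x ⋖ p → y ⋖ p → x ≡ y
    only-child p q = depth-injective n _ _
      (trans (depth-parent (finite n) p) (sym (depth-parent (finite n) q)))

  below-ω : ∀ n ρ → ρ ≤ finite n → ∃[ m ] ρ ≈ finite m
  below-ω zero    ρ ρ≤ = 0 , ρ≤ , 0≤ ρ
  below-ω (suc n) ρ ρ≤ with ≤-or-> ρ (finite n)
  ... | inj₁ p = below-ω n ρ p
  ... | inj₂ p = suc n , ρ≤ , <⇒sucₒ≤ (finite n) ρ p

theorem3p1 : (ℓ : Level) → ExcludedMiddle (lsuc ℓ) →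
    Λ-T ℓ ≐ (_< ω) ∪ (λ ρ → ∃[ α ] IsLimit α × (ρ ≈ α ⊕ ω))
theorem3p1 ℓ em = necessary , sufficient
  where
  open Classical em

  necessary : ∀ {ρ} → Λ-T ℓ ρ → ρ ∈ (_< ω) ∪ (λ ρ → ∃[ α ] IsLimit α × (ρ ≈ α ⊕ ω))
  necessary {ρ} (T , (conn , ¬cycle) , cop , cr) = CopWinTree.classify T conn ¬cycle cop ρ cr

  sufficient : ∀ {ρ} → ρ ∈ (_< ω) ∪ (λ ρ → ∃[ α ] IsLimit α × (ρ ≈ α ⊕ ω)) → Λ-T ℓ ρ
  sufficient {ρ} (inj₁ (lift n , ρ≤)) = let m , ρ≈ = below-ω n ρ ρ≤ in finite-realised m ρ ρ≈
  sufficient {ρ} (inj₂ (α , lim , ρ≈)) = Realise.limit-realised α lim ρ ρ≈
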